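{- Let $G$ be a digraph that has a doubly bidirectionally connected pair $(p,q)$, and let $\varphi\colon G'\to G$ be an expansion of $G$. Then $G'$ is not a cactus digraph.
   Context: A digraph is a pair $G=(V,A)$ with $V$ a finite set of vertices and $A\subset V\times V$ a set of arcs, without loops: $(v,v)\notin A$ for all $v\in V$. An arc $(x,y)$ is an arc from $x$ to $y$. A path of length $n$ from $x$ to $y$ is a sequence of vertices $(x_0,x_1,\dots,x_n)$ with $x_0=x$, $x_n=y$ and $(x_{i-1},x_i)\in A$ for $1\le i\le n$. The vertex $x_{n-1}$ is called the preterminal vertex of the path. A path is simple if $x_0,\dots,x_n$ are distinct. A cycle is a path (of length $n\ge 1$) with $x_0=x_n$; it is simple if $x_0,\dots,x_{n-1}$ are distinct. Cycles are regarded as subdigraphs, i.e. cycles that differ only in the choice of starting vertex (cyclic rotation) are the same cycle. $G$ is strongly connected if for any $x,y\in V$ there is a path from $x$ to $y$. A digraph morphism $\varphi\colon G'\to G$ from $G'=(V',A')$ to $G=(V,A)$ is a pair of maps $\varphi_V\colon V'\to V$, $\varphi_A\colon A'\to A$ with $\varphi_A((v',w'))=(\varphi_V(v'),\varphi_V(w'))$ for every $(v',w')\in A'$. An expansion of $G$ is a digraph $G'=(V',A')$ together with a digraph morphism $\varphi\colon G'\to G$ such that $\varphi_V$ is surjective, $\varphi_A$ is surjective, and whenever $(x,y)\in A$, $y'\in V'$ and $\varphi_V(y')=y$, there exists a unique arc $(x',y')\in A'$ (with terminal vertex $y'$) such that $\varphi_V(x')=x$. A cactus digraph is a strongly connected digraph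 in which each arc is contained in exactly one simple cycle (the digraph with a single vertex and no arc is a cactus digraph). A doubly bidirectionally connected pair of $G=(V,A)$ is a pair $(p,q)\in V\times V$ such that $p\ne q$, there exist two simple paths from $p$ to $q$ with different preterminal vertices, and there exist two simple paths from $q$ to $p$ with different preterminal vertices. -}

module Defs where

open import Data.Bool.Base using (Bool; T)
open import Data.Fin.Base using (Fin; zero; suc; fromℕ; inject₁)
open import Data.Nat.Base using (ℕ; suc; _+_)
open import Data.Nat.DivMod using (_mod_)
open import Data.Product using (Σ; ∃; ∃₂; ∃!; _×_; _,_; proj₁; map)
open import Function.Bundles using (_↔_)
open import Function.Definitions using (Injective; Surjective)
open import Function.Base using (_∘_)
open import Relation.Binary.PropositionalEquality using (_≡_; _≢_)
open import Relation.Nullary using (¬_)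

-- The arc set is a Boolean-valued subset of V × V, so that an arc is
-- determined by its two ends: T (arc x y) is proof-irrelevant.
record Digraph : Set₁ where
  field
    V        : Set
    order    : ℕ
    finite   : V ↔ Fin order
    arc      : V → V → Bool
    loopless : ∀ v → ¬ T (arc v v)

  Arc : V → V → Set
  Arc x y = T (arc x y)

  A : Set
  A = Σ (V × V) λ (x , y) → Arc x y

  ends : A → V × V
  ends = proj₁

module _ (G : Digraph) where
  open Digraph G

  record Path (n : ℕ) (x y : V) : Set where
    field
      vertex : Fin (suc n) → V
      start  : vertex zero ≡ x
      end    : vertex (fromℕ n) ≡ y
      step   : ∀ (i : Fin n) → Arc (vertex (inject₁ i)) (vertex (suc i))

  open Path

  -- Only paths of positive length have a preterminal vertex.
  preterminal : ∀ {n x y} → Path (suc n) x y → V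
  preterminal {n} π = vertex π (inject₁ (fromℕ n))

  SimplePath : ∀ {n x y} → Path n x y → Set
  SimplePath π = Injective _≡_ _≡_ (vertex π)

  StronglyConnected : Set
  StronglyConnected = ∀ x y → ∃ λ n → Path n x y

  -- The vertices x₀, …, xₘ are distinct and xₘ₊₁ = x₀ = base.
  record SimpleCycle : Set where
    field
      {m}    : ℕ
      {base} : V
      path   : Path (suc m) base base
      simple : Injective _≡_ _≡_ (vertex path ∘ inject₁)

    length : ℕ
    length = suc m

    -- x_(i mod length)
    at : ℕ → V
    at i = vertex path (inject₁ (i mod length))

    Contains : V → V → Set
    Contains x y = ∃ λ (i : Fin length) →
      vertex path (inject₁ i) ≡ x × vertex path (suc i) ≡ y

  open SimpleCycle

  -- Equality of cycles up to the choice of the starting vertex.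
  SameCycle : SimpleCycle → SimpleCycle → Set
  SameCycle C D =
    length C ≡ length D × ∃ λ k → ∀ i → at D i ≡ at C (i + k)

  IsCactus : Set
  IsCactus =
    StronglyConnected ×
    (∀ x y → Arc x y → ∃! SameCycle λ C → Contains C x y)

  TwoSimplePaths : V → V → Set
  TwoSimplePaths x y =
    ∃₂ λ m n → Σ (Path (suc m) x y) λ π → Σ (Path (suc n) x y) λ ρ →
      SimplePath π × SimplePath ρ × preterminal π ≢ preterminal ρ

  DoublyBidirectionallyConnected : V → V → Set
  DoublyBidirectionallyConnected p q =
    p ≢ q × TwoSimplePaths p q × TwoSimplePaths q p

open Digraph

record Morphism (G′ G : Digraph) : Set where
  field
    φV      : V G′ → V G
    φA      : A G′ → A G
    φA-ends : ∀ a → ends G (φA a) ≡ map φV φV (ends G′ a)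

record IsExpansion {G′ G : Digraph} (φ : Morphism G′ G) : Set where
  open Morphism φ
  field
    φV-surjective : Surjective _≡_ _≡_ φV
    φA-surjective : Surjective _≡_ _≡_ φA
    -- An arc into y′ is determined by its initial vertex x′.
    unique-lift   : ∀ x y → Arc G x y → ∀ y′ → φV y′ ≡ y →
                    ∃! _≡_ λ x′ → Arc G′ x′ y′ × φV x′ ≡ x

-- If G′ were a cactus, simple walks in it could be prolonged backwards for
-- ever.  Let a simple walk start with the arc (x , z), x over p, and let C be
-- the simple cycle through (x , z).  Both simple paths from q to p lift to paths
-- ending at x, with different preterminal vertices, and at most one of these
-- precedes x on C; follow the other lift backwards from x.  If it met the walk
-- again, the two would close up to a simple cycle through (x , z) other than C.
-- So one gets a longer simple walk, starting over q, and the same argument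
-- applies with p and q exchanged.
module Submission where

open import Defs
open import Data.Fin.Base as Fin using (Fin; toℕ; fromℕ; fromℕ<; inject₁)
open import Data.Fin.Properties using
  (toℕ-fromℕ; toℕ-inject₁; toℕ-fromℕ<; toℕ<n; toℕ-injective;
   inject₁-injective; suc-injective; fromℕ≢inject₁; inj⇒≟; any?; injective⇒≤)
open import Data.Fin.Relation.Unary.Top using (view; ‵fromℕ; ‵inject₁)
open import Data.Nat.Base using (ℕ; zero; suc; _+_; _≤_; _<_; z≤n; s≤s; s≤s⁻¹)
open import Data.Nat.DivMod using (_mod_; _%_; m%n<n; m<n⇒m%n≡m; n%n≡0; %-distribˡ-+; m%n%n≡m%n)
open import Data.Nat.Properties using
  (≤-refl; ≤-trans; ≤-<-trans; <-trans; <-irrefl; n≤1+n; _≤?_; ≰⇒>)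
open import Data.Product using (_×_; _,_; proj₁)
open import Data.Sum using (_⊎_; inj₁; inj₂)
open import Function.Base using (_∘_)
open import Function.Bundles using (module Inverse)
open import Function.Definitions using (Injective)
open import Function.Properties.Inverse using (Inverse⇒Injection)
open import Relation.Binary.Definitions using (DecidableEquality)
open import Relation.Binary.PropositionalEquality using
  (_≡_; _≢_; refl; sym; trans; cong; subst; module ≡-Reasoning)
open import Relation.Nullary using (¬_; yes; no; contradiction)
open import Relation.Nullary.Decidable using (Dec; _×-dec_)

-- Indices modulo the length of a cycle.

toℕ-mod : ∀ i n → toℕ (i mod suc n) ≡ i % suc n
toℕ-mod i n = toℕ-fromℕ< (m%n<n i (suc n))

mod-toℕ : ∀ {n} (i : Fin (suc n)) → toℕ i mod suc n ≡ i
mod-toℕ {n} i = toℕ-injective (trans (toℕ-mod (toℕ i) n) (m<n⇒m%n≡m (toℕ<n i)))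

cyclicSuc : ∀ {n} → Fin (suc n) → Fin (suc n)
cyclicSuc {n} i = suc (toℕ i) mod suc n

cyclicSuc-fromℕ : ∀ n → cyclicSuc (fromℕ n) ≡ Fin.zero
cyclicSuc-fromℕ n = toℕ-injective (begin
  toℕ (cyclicSuc (fromℕ n))      ≡⟨ toℕ-mod (suc (toℕ (fromℕ n))) n ⟩
  suc (toℕ (fromℕ n)) % suc n    ≡⟨ cong (λ k → suc k % suc n) (toℕ-fromℕ n) ⟩
  suc n % suc n                  ≡⟨ n%n≡0 (suc n) ⟩
  0                              ∎)
  where open ≡-Reasoning

cyclicSuc-inject₁ : ∀ {n} (i : Fin n) → cyclicSuc (inject₁ i) ≡ Fin.suc i
cyclicSuc-inject₁ {n} i = trans (cong (λ k → suc k mod suc n) (toℕ-inject₁ i)) (mod-toℕ (Fin.suc i))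

cyclicSuc-injective : ∀ {n} → Injective _≡_ _≡_ (cyclicSuc {n})
cyclicSuc-injective {n} {i} {j} eq with view i | view j
... | ‵fromℕ     | ‵fromℕ     = refl
... | ‵inject₁ i | ‵inject₁ j = cong inject₁ (suc-injective
  (trans (sym (cyclicSuc-inject₁ i)) (trans eq (cyclicSuc-inject₁ j))))
... | ‵fromℕ     | ‵inject₁ j with () ←
  trans (sym (cyclicSuc-fromℕ n)) (trans eq (cyclicSuc-inject₁ j))
... | ‵inject₁ i | ‵fromℕ with () ←
  trans (sym (cyclicSuc-fromℕ n)) (trans (sym eq) (cyclicSuc-inject₁ i))

suc-mod : ∀ i n → suc i mod suc n ≡ cyclicSuc (i mod suc n)
suc-mod i n = toℕ-injective (begin
  toℕ (suc i mod suc n)                      ≡⟨ toℕ-mod (suc i) n ⟩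
  (1 + i) % suc n                            ≡⟨ %-distribˡ-+ 1 i (suc n) ⟩
  (1 % suc n + i % suc n) % suc n            ≡⟨ cong (λ k → (1 % suc n + k) % suc n) (m%n%n≡m%n i (suc n)) ⟨
  (1 % suc n + i % suc n % suc n) % suc n    ≡⟨ %-distribˡ-+ 1 (i % suc n) (suc n) ⟨
  suc (i % suc n) % suc n                    ≡⟨ cong (λ k → suc k % suc n) (toℕ-mod i n) ⟨
  suc (toℕ (i mod suc n)) % suc n            ≡⟨ toℕ-mod (suc (toℕ (i mod suc n))) n ⟨
  toℕ (cyclicSuc (i mod suc n))              ∎)
  where open ≡-Reasoning

infixr 5 _◂_

-- Walks are functions on all of `ℕ`, so that prepending a vertex shifts indices by computation
-- alone, without casts between `Fin` types.
_◂_ : {X : Set} → X → (ℕ → X) → ℕ → X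
(x ◂ g) zero    = x
(x ◂ g) (suc i) = g i

-- Simple cycles and simple walks in a digraph.

module _ (G : Digraph) where
  open Digraph G
  open Path
  open SimpleCycle

  V-≟ : DecidableEquality V
  V-≟ = inj⇒≟ (Inverse⇒Injection finite)

  Contains? : ∀ (C : SimpleCycle G) x y → Dec (Contains C x y)
  Contains? C x y = any? λ i →
    V-≟ (vertex (path C) (inject₁ i)) x ×-dec V-≟ (vertex (path C) (Fin.suc i)) y

  -- `simple` speaks of initial vertices of arcs only, so a terminal vertex is turned into the
  -- initial vertex of the next arc; for the last arc this is the return to the base.
  vertex-suc : ∀ (C : SimpleCycle G) i → vertex (path C) (Fin.suc i) ≡ vertex (path C) (inject₁ (cyclicSuc i))
  vertex-suc C i with view i
  ... | ‵fromℕ     = trans (trans (end (path C)) (sym (start (path C))))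
    (cong (vertex (path C) ∘ inject₁) (sym (cyclicSuc-fromℕ (m C))))
  ... | ‵inject₁ i = cong (vertex (path C) ∘ inject₁) (sym (cyclicSuc-inject₁ i))

  at-suc : ∀ (C : SimpleCycle G) i → at C (suc i) ≡ vertex (path C) (Fin.suc (i mod length C))
  at-suc C i = trans (cong (vertex (path C) ∘ inject₁) (suc-mod i (m C)))
                     (sym (vertex-suc C (i mod length C)))

  -- By simplicity the arc leaving `x` has only one index; as `cyclicSuc` is injective, so has the
  -- arc entering `x`.
  predecessor-unique : ∀ (C : SimpleCycle G) {a b x} → Contains C a x → Contains C b x → a ≡ b
  predecessor-unique C (i , i≡a , si≡x) (j , j≡b , sj≡x) =
    trans (sym i≡a) (trans (cong (vertex (path C) ∘ inject₁) i≡j) j≡b)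
    where
    i≡j : i ≡ j
    i≡j = cyclicSuc-injective (simple C (trans (sym (vertex-suc C i))
      (trans si≡x (trans (sym sj≡x) (vertex-suc C j)))))

  -- Comparing vertices at two consecutive positions shows that arc `i` of `D` is arc `i + k` of
  -- `C`, indices taken modulo the length.
  SameCycle-Contains : ∀ C D {x y} → SameCycle G C D → Contains D x y → Contains C x y
  SameCycle-Contains C D {x} {y} (_ , k , D≡C) (i , i≡x , si≡y) =
    (toℕ i + k) mod length C , at-x , at-y
    where
    open ≡-Reasoning
    at-x : at C (toℕ i + k) ≡ x
    at-x = begin
      at C (toℕ i + k)             ≡⟨ D≡C (toℕ i) ⟨
      at D (toℕ i)                 ≡⟨ cong (vertex (path D) ∘ inject₁) (mod-toℕ i) ⟩
      vertex (path D) (inject₁ i)  ≡⟨ i≡x ⟩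
      x                            ∎
    at-y : vertex (path C) (Fin.suc ((toℕ i + k) mod length C)) ≡ y
    at-y = begin
      vertex (path C) (Fin.suc ((toℕ i + k) mod length C))  ≡⟨ at-suc C (toℕ i + k) ⟨
      at C (suc (toℕ i) + k)                                ≡⟨ D≡C (suc (toℕ i)) ⟨
      at D (suc (toℕ i))                                    ≡⟨ at-suc D (toℕ i) ⟩
      vertex (path D) (Fin.suc (toℕ i mod length D))        ≡⟨ cong (vertex (path D) ∘ Fin.suc) (mod-toℕ i) ⟩
      vertex (path D) (Fin.suc i)                           ≡⟨ si≡y ⟩
      y                                                     ∎

  -- Only the values g 0, …, g n matter.
  record SimpleWalk (n : ℕ) (g : ℕ → V) : Set where
    field
      arcs     : ∀ {i} → i < n → Arc (g i) (g (suc i))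
      distinct : ∀ {i j} → i ≤ n → j ≤ n → g i ≡ g j → i ≡ j

  open SimpleWalk

  -- Pigeonhole: a walk has one vertex more than arcs, whence the strict inequality.
  SimpleWalk-bounded : ∀ {n g} → SimpleWalk n g → n < order
  SimpleWalk-bounded {n} {g} w = injective⇒≤ {f = Inverse.to finite ∘ g ∘ toℕ} inj
    where
    inj : Injective _≡_ _≡_ (Inverse.to finite ∘ g ∘ toℕ)
    inj {i} {j} eq = toℕ-injective (distinct w (s≤s⁻¹ (toℕ<n i)) (s≤s⁻¹ (toℕ<n j))
      (trans (sym (Inverse.strictlyInverseʳ finite _))
        (trans (cong (Inverse.from finite) eq) (Inverse.strictlyInverseʳ finite _))))

  -- `distinct` stops at index `n`, so `g (suc n)` is free to repeat `g 0`.
  closedWalk : ∀ {n g} → SimpleWalk n g → Arc (g n) (g (suc n)) → g (suc n) ≡ g 0 → SimpleCycle G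
  closedWalk {n} {g} w arcₙ eq = record
    { path = record
      { vertex = g ∘ toℕ
      ; start  = refl
      ; end    = trans (cong (g ∘ suc) (toℕ-fromℕ n)) eq
      ; step   = arc-at
      }
    ; simple = λ {i} {j} gi≡gj → toℕ-injective (distinct w (s≤s⁻¹ (toℕ<n i)) (s≤s⁻¹ (toℕ<n j))
        (trans (cong g (sym (toℕ-inject₁ i))) (trans gi≡gj (cong g (toℕ-inject₁ j)))))
    }
    where
    arc-at : ∀ (i : Fin (suc n)) → Arc (g (toℕ (inject₁ i))) (g (suc (toℕ i)))
    arc-at i with view i
    ... | ‵fromℕ rewrite toℕ-inject₁ (fromℕ n) | toℕ-fromℕ n = arcₙ
    ... | ‵inject₁ i rewrite toℕ-inject₁ (inject₁ i) | toℕ-inject₁ i = arcs w (toℕ<n i)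

  closedWalk-Contains : ∀ {n g} (w : SimpleWalk n g) arcₙ eq {i} → i ≤ n →
    Contains (closedWalk w arcₙ eq) (g i) (g (suc i))
  closedWalk-Contains {g = g} _ _ _ i≤n =
    fromℕ< (s≤s i≤n) ,
    cong g (trans (toℕ-inject₁ _) (toℕ-fromℕ< (s≤s i≤n))) ,
    cong (g ∘ suc) (toℕ-fromℕ< (s≤s i≤n))

  -- For arcs from `u` to `x` and from `x` to `z` in a cactus, this says that the simple cycles
  -- through them differ.
  NoCommonCycle : V → V → V → Set
  NoCommonCycle u x z = ∀ (C : SimpleCycle G) → Contains C u x → ¬ Contains C x z

  ◂-simple : ∀ {n g u} → SimpleWalk n g → Arc u (g 0) → (∀ {i} → i ≤ n → u ≢ g i) →
    SimpleWalk (suc n) (u ◂ g)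
  ◂-simple {n} {g} {u} w u→g₀ u∉g = record { arcs = arcs′ ; distinct = distinct′ }
    where
    arcs′ : ∀ {i} → i < suc n → Arc ((u ◂ g) i) (g i)
    arcs′ {zero}  _         = u→g₀
    arcs′ {suc i} (s≤s i<n) = arcs w i<n
    distinct′ : ∀ {i j} → i ≤ suc n → j ≤ suc n → (u ◂ g) i ≡ (u ◂ g) j → i ≡ j
    distinct′ {zero}  {zero}  _ _ _ = refl
    distinct′ {zero}  {suc j} _ (s≤s j≤n) eq = contradiction eq (u∉g j≤n)
    distinct′ {suc i} {zero}  (s≤s i≤n) _ eq = contradiction (sym eq) (u∉g i≤n)
    distinct′ {suc i} {suc j} (s≤s i≤n) (s≤s j≤n) eq = cong suc (distinct w i≤n j≤n eq)

  SimpleWalk-prefix : ∀ {m n g} → m ≤ n → SimpleWalk n g → SimpleWalk m g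
  SimpleWalk-prefix m≤n w = record
    { arcs     = λ i<m → arcs w (≤-trans i<m m≤n)
    ; distinct = λ i≤m j≤m → distinct w (≤-trans i≤m m≤n) (≤-trans j≤m m≤n)
    }

  -- Returning to g i with i > j would close a simple cycle running through the
  -- three consecutive vertices at j, suc j and 2 + j of u ◂ g.
  ◂-avoids : ∀ {n g u} j → SimpleWalk n g → Arc u (g 0) → (∀ {i} → i ≤ j → u ≢ g i) →
    NoCommonCycle ((u ◂ g) j) (g j) (g (suc j)) → ∀ {i} → i ≤ n → u ≢ g i
  ◂-avoids {n} {g} {u} j w u→g₀ u∉ noCycle {i} i≤n u≡gᵢ with i ≤? j
  ... | yes i≤j = u∉ i≤j u≡gᵢ
  ... | no  i≰j = closes i (≰⇒> i≰j) i≤n u≡gᵢ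
    where
    closes : ∀ i → j < i → i ≤ n → u ≢ g i
    closes (suc i) (s≤s j≤i) i<n u≡gᵢ = noCycle (closedWalk w′ gᵢ→gₛᵢ (sym u≡gᵢ))
      (closedWalk-Contains w′ gᵢ→gₛᵢ (sym u≡gᵢ) (≤-trans j≤i (n≤1+n i)))
      (closedWalk-Contains w′ gᵢ→gₛᵢ (sym u≡gᵢ) (s≤s j≤i))
      where
      gᵢ→gₛᵢ : Arc (g i) (g (suc i))
      gᵢ→gₛᵢ = arcs w i<n
      -- Cut just before the repetition, the walk does not meet `u`, since `u` equals `g (suc i)`.
      w′ : SimpleWalk (suc i) (u ◂ g)
      w′ = ◂-simple (SimpleWalk-prefix (≤-trans (n≤1+n i) i<n) w) u→g₀ λ {k} k≤i u≡gₖ →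
        <-irrefl (distinct w (≤-trans k≤i (≤-trans (n≤1+n i) i<n)) i<n (trans (sym u≡gₖ) u≡gᵢ)) (s≤s k≤i)

  -- Every simple cycle through the arc from `x` to `z` is `C` up to rotation, so it suffices to
  -- decide whether `C` enters `x` from `a`; if it does, it does not enter from `b`.
  cactus-choice : IsCactus G → ∀ {a b x z} → a ≢ b → Arc x z →
    NoCommonCycle a x z ⊎ NoCommonCycle b x z
  cactus-choice (_ , unique) {a} {b} {x} {z} a≢b x→z with unique x z x→z
  ... | C , _ , C-unique with Contains? C a x
  ...   | yes C∋ax = inj₂ λ D D∋bx D∋xz → a≢b
    (predecessor-unique C C∋ax (SameCycle-Contains C D (C-unique {D} D∋xz) D∋bx))
  ...   | no  C∌ax = inj₁ λ D D∋ax D∋xz →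
    C∌ax (SameCycle-Contains C D (C-unique {D} D∋xz) D∋ax)

  init : ∀ {n x y} (π : Path G (suc n) x y) → Path G n x (preterminal G π)
  init π = record
    { vertex = vertex π ∘ inject₁
    ; start  = start π
    ; end    = refl
    ; step   = step π ∘ inject₁
    }

  lastArc : ∀ {n x y} (π : Path G (suc n) x y) → Arc (preterminal G π) y
  lastArc {n} π = subst (Arc _) (end π) (step π (fromℕ n))

-- Lifting simple paths along an expansion.

module _ {G G′ : Digraph} (φ : Morphism G′ G) (φ-expansion : IsExpansion φ) where
  open Digraph
  open Path
  open SimpleWalk
  open Morphism φ
  open IsExpansion φ-expansion

  -- The strict bound guarantees an arc from `g 0` to `g 1` even for `N = 0`.
  record LongWalk (N : ℕ) (x : V G) : Set where
    constructor longWalk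
    field
      {n}  : ℕ
      {g}  : ℕ → V G′
      N<n  : N < n
      walk : SimpleWalk G′ n g
      over : φV (g 0) ≡ x

  weaken : ∀ {M N x} → M ≤ N → LongWalk N x → LongWalk M x
  weaken M≤N (longWalk N<n w o) = longWalk (≤-<-trans M≤N N<n) w o

  -- The vertices g 0, …, g j lie over the part of a simple path already lifted,
  -- ρ is the part still to be lifted, and u lies over its preterminal vertex.
  lift-simple : ∀ {m n s t g u} j (ρ : Path G (suc m) s t) →
    SimpleWalk G′ n g → Arc G′ u (g 0) → φV u ≡ preterminal G ρ →
    (∀ {i} → i ≤ j → ∀ k → vertex ρ (inject₁ k) ≢ φV (g i)) →
    NoCommonCycle G′ ((u ◂ g) j) (g j) (g (suc j)) → SimpleWalk G′ (suc n) (u ◂ g)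
  lift-simple {m} j ρ w u→g₀ φu new noCycle = ◂-simple G′ w u→g₀ (◂-avoids G′ j w u→g₀
    (λ i≤j u≡gᵢ → new i≤j (fromℕ m) (trans (sym φu) (cong φV u≡gᵢ))) noCycle)

  -- Induction on the length of `ρ`: its remaining arcs are lifted from last to first, each ending
  -- at the vertex lifted before.
  extend : ∀ {m n s t g u} j (ρ : Path G (suc m) s t) → SimplePath G ρ →
    SimpleWalk G′ n g → Arc G′ u (g 0) → φV u ≡ preterminal G ρ →
    (∀ {i} → i ≤ j → ∀ k → vertex ρ (inject₁ k) ≢ φV (g i)) →
    NoCommonCycle G′ ((u ◂ g) j) (g j) (g (suc j)) → LongWalk n s
  extend {zero} j ρ ρ-simple w u→g₀ φu new noCycle =
    longWalk ≤-refl (lift-simple j ρ w u→g₀ φu new noCycle) (trans φu (start ρ))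
  extend {suc m} {n} {g = g} {u} j ρ ρ-simple w u→g₀ φu new noCycle
    with v , (v→u , φv) , _ ← unique-lift _ _ (lastArc G (init G ρ)) u φu =
      -- `noCycle` is passed on unchanged: prepending `u` to `g` and raising `j` by one leaves its
      -- three vertices the same.
      weaken (n≤1+n n) (extend (suc j) (init G ρ) (λ eq → inject₁-injective (ρ-simple eq))
        (lift-simple j ρ w u→g₀ φu new noCycle) v→u φv new′ noCycle)
    where
    new′ : ∀ {i} → i ≤ suc j → ∀ k → vertex ρ (inject₁ (inject₁ k)) ≢ φV ((u ◂ g) i)
    new′ {zero}  _ k eq = fromℕ≢inject₁ (inject₁-injective (ρ-simple (sym (trans eq φu))))
    new′ {suc i} (s≤s i≤j) k = new i≤j (inject₁ k)

  -- Prolonging walks in a cactus without end.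

  module _ (cactus : IsCactus G′) where

    grow : ∀ {s t N} → TwoSimplePaths G s t → LongWalk N t → LongWalk (suc N) s
    grow {s} {t} {N} (_ , _ , π , ρ , π-simple , ρ-simple , π≢ρ) (longWalk {n} {g} N<n w φg₀)
      with a , (a→g₀ , φa) , _ ← unique-lift _ _ (lastArc G π) (g 0) φg₀
         | b , (b→g₀ , φb) , _ ← unique-lift _ _ (lastArc G ρ) (g 0) φg₀ =
      case (cactus-choice G′ cactus a≢b (arcs w 0<n))
      where
      0<n : 0 < n
      0<n = ≤-<-trans z≤n N<n
      a≢b : a ≢ b
      a≢b a≡b = π≢ρ (trans (sym φa) (trans (cong φV a≡b) φb))
      along : ∀ {m u} (π : Path G (suc m) s t) → SimplePath G π → Arc G′ u (g 0) →
        φV u ≡ preterminal G π → NoCommonCycle G′ u (g 0) (g 1) → LongWalk (suc N) s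
      along π π-simple u→g₀ φu noCycle =
        weaken N<n (extend 0 π π-simple w u→g₀ φu
          -- At first only `g 0` counts as lifted; it lies over the end `t`, which a simple path
          -- does not visit earlier.
          (λ { z≤n k eq → fromℕ≢inject₁ (π-simple (trans (end π) (trans (sym φg₀) (sym eq)))) })
          noCycle)
      case : NoCommonCycle G′ a (g 0) (g 1) ⊎ NoCommonCycle G′ b (g 0) (g 1) → LongWalk (suc N) s
      case (inj₁ noCycle) = along π π-simple a→g₀ φa noCycle
      case (inj₂ noCycle) = along ρ ρ-simple b→g₀ φb noCycle

    -- Surjectivity on arcs supplies the walk to start from; its two vertices differ because `G′`
    -- has no loops.
    singleArc : ∀ {x y} → Arc G x y → LongWalk 0 x
    singleArc {x} {y} x→y with φA-surjective ((x , y) , x→y)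
    ... | a@((x′ , y′) , x′→y′) , φa = longWalk {g = x′ ◂ λ _ → y′} ≤-refl
      (◂-simple G′ point x′→y′ (λ _ x′≡y′ → loopless G′ y′ (subst (λ v → Arc G′ v y′) x′≡y′ x′→y′)))
      (cong proj₁ (trans (sym (φA-ends a)) (cong (ends G) (φa refl))))
      where
      point : SimpleWalk G′ 0 (λ _ → y′)
      point = record { arcs = λ () ; distinct = λ { z≤n z≤n _ → refl } }

    longWalks : ∀ {p q} → TwoSimplePaths G p q → TwoSimplePaths G q p → ∀ N → LongWalk N p
    longWalks (_ , _ , π , _) _ zero =
      singleArc (subst (λ v → Arc G v (vertex π (Fin.suc Fin.zero))) (start π) (step π Fin.zero))
    -- The first round leads from over `p` to over `q`, the second back to over `p`; the bound rises
    -- by two, one more than needed.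
    longWalks pq qp (suc N) = weaken (n≤1+n (suc N)) (grow pq (grow qp (longWalks pq qp N)))

theorem1 : (G : Digraph) (p q : Digraph.V G) →
    DoublyBidirectionallyConnected G p q →
    (G′ : Digraph) (φ : Morphism G′ G) → IsExpansion φ →
    ¬ IsCactus G′
theorem1 G p q (_ , pq , qp) G′ φ φ-expansion cactus
  with longWalk order<n w _ ← longWalks φ φ-expansion cactus pq qp (Digraph.order G′) =
  <-irrefl refl (<-trans order<n (SimpleWalk-bounded G′ w))
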